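{- The Robertson graph is not a $(4,5,3)$-equitable cage; that is, the Robertson graph (which is a $4$-regular graph of girth $5$ and chromatic number $3$ on $19$ vertices) admits no proper $3$-coloring whose color classes have sizes differing pairwise by at most one (equivalently, no proper $3$-coloring with color class sizes $6,6,7$).
   Context: All graphs are finite and simple. The Robertson graph is the unique $(4,5)$-cage, i.e. the unique $4$-regular graph of girth $5$ with the minimum possible number of vertices, namely $19$. A proper vertex coloring is equitable if the sizes of any two color classes differ by at most one. An $(r,g,\chi)$-graph is an $r$-regular graph with girth exactly $g$ and chromatic number exactly $\chi$; an $(r,g,\chi)$-equitable graph is one admitting an equitable proper $\chi$-coloring, and an $(r,g,\chi)$-equitable cage is an $(r,g,\chi)$-equitable graph of minimum order. -}

module Defs where

open import Data.Fin using (Fin; toℕ; _≟_)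
open import Data.Fin.Properties using (all?)
open import Data.List using (List; []; _∷_; _∷ʳ_; length; filter; allFin)
open import Data.List.Membership.Propositional using (_∈_)
open import Data.List.Relation.Unary.Linked using (Linked)
open import Data.List.Relation.Unary.Unique.Propositional using (Unique)
import Data.List.Membership.DecPropositional as DecMembership
import Data.Nat as ℕ
open import Data.Nat using (ℕ; _≤_; ∣_-_∣)
open import Data.Product using (Σ; ∃; _×_)
open import Data.Vec as Vec using (Vec; lookup)
open import Function using (_↔_; _⇔_; Inverse)
open import Level using (0ℓ)
open import Relation.Binary using (Rel; Decidable; Symmetric; Irreflexive)
open import Relation.Binary.PropositionalEquality using (_≡_; _≢_; refl)
open import Relation.Nullary using (¬_)
open import Relation.Nullary.Decidable using (toWitness; ¬?; _→-dec_)

-- Finite simple graphs of order n, with vertex set Fin n.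
record Graph (n : ℕ) : Set₁ where
  infix 4 _~_ _~?_
  field
    _~_    : Rel (Fin n) 0ℓ
    _~?_   : Decidable _~_
    sym    : Symmetric _~_
    irrefl : Irreflexive _≡_ _~_

  degree : Fin n → ℕ
  degree v = length (filter (v ~?_) (allFin n))

  -- The cycle v, vs₁, …, vsₖ (and back to v), whose length is k + 1.
  record IsCycle (v : Fin n) (vs : List (Fin n)) : Set where
    field
      length≥3 : 3 ≤ length (v ∷ vs)
      distinct : Unique (v ∷ vs)
      closed   : Linked _~_ (v ∷ vs ∷ʳ v)

  IsProper : ∀ {k} → (Fin n → Fin k) → Set
  IsProper c = ∀ {u v} → u ~ v → c u ≢ c v

open Graph public using (degree; IsCycle; IsProper)

private variable
  m n k : ℕ

infix 4 _≅_
_≅_ : Graph m → Graph n → Set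
_≅_ {m} {n} G H =
  Σ (Fin m ↔ Fin n) λ f → ∀ u v → (u G.~ v) ⇔ (Inverse.to f u H.~ Inverse.to f v)
  where
  module G = Graph G
  module H = Graph H

IsRegular : ℕ → Graph n → Set
IsRegular r G = ∀ v → degree G v ≡ r

HasGirth : ℕ → Graph n → Set
HasGirth g G =
  (∃ λ v → ∃ λ vs → IsCycle G v vs × length (v ∷ vs) ≡ g) ×
  (∀ v vs → IsCycle G v vs → g ≤ length (v ∷ vs))

IsColorable : ℕ → Graph n → Set
IsColorable {n} k G = ∃ λ (c : Fin n → Fin k) → IsProper G c

HasChromaticNumber : ℕ → Graph n → Set
HasChromaticNumber χ G = IsColorable χ G × (∀ k → IsColorable k G → χ ≤ k)

classSize : (Fin n → Fin k) → Fin k → ℕ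
classSize {n} c a = length (filter (λ v → c v ≟ a) (allFin n))

-- The condition ranges over all k colors, so an unused color counts as a class
-- of size 0.
IsEquitable : (Fin n → Fin k) → Set
IsEquitable c = ∀ a b → ∣ classSize c a - classSize c b ∣ ≤ 1

IsEquitablyColorable : ℕ → Graph n → Set
IsEquitablyColorable {n} k G =
  ∃ λ (c : Fin n → Fin k) → IsProper G c × IsEquitable c

IsRGGraph : ℕ → ℕ → Graph n → Set
IsRGGraph r g G = IsRegular r G × HasGirth g G

IsCage : ℕ → ℕ → Graph n → Set₁
IsCage {n} r g G =
  IsRGGraph r g G × (∀ {m} (H : Graph m) → IsRGGraph r g H → n ≤ m)

IsUniqueCage : ℕ → ℕ → Graph n → Set₁
IsUniqueCage r g G =
  IsCage r g G × (∀ {m} (H : Graph m) → IsCage r g H → H ≅ G)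

IsRGχGraph : ℕ → ℕ → ℕ → Graph n → Set
IsRGχGraph r g χ G = IsRegular r G × HasGirth g G × HasChromaticNumber χ G

IsEquitableGraph : ℕ → ℕ → ℕ → Graph n → Set
IsEquitableGraph r g χ G = IsRGχGraph r g χ G × IsEquitablyColorable χ G

IsEquitableCage : ℕ → ℕ → ℕ → Graph n → Set₁
IsEquitableCage {n} r g χ G =
  IsEquitableGraph r g χ G ×
  (∀ {m} (H : Graph m) → IsEquitableGraph r g χ H → n ≤ m)

-- The Robertson graph, drawn on the Hamiltonian cycle 0, 1, …, 18: entry i lists
-- the neighbors of vertex i.  It is 4-regular of girth 5, which characterizes it up
-- to isomorphism among the graphs on 19 vertices.
robertsonNeighbors : Vec (List ℕ) 19
robertsonNeighbors =
  (1 ∷ 4 ∷ 7 ∷ 18 ∷ []) Vec.∷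
  (0 ∷ 2 ∷ 9 ∷ 12 ∷ []) Vec.∷
  (1 ∷ 3 ∷ 6 ∷ 14 ∷ []) Vec.∷
  (2 ∷ 4 ∷ 8 ∷ 11 ∷ []) Vec.∷
  (0 ∷ 3 ∷ 5 ∷ 15 ∷ []) Vec.∷
  (4 ∷ 6 ∷ 13 ∷ 17 ∷ []) Vec.∷
  (2 ∷ 5 ∷ 7 ∷ 10 ∷ []) Vec.∷
  (0 ∷ 6 ∷ 8 ∷ 16 ∷ []) Vec.∷
  (3 ∷ 7 ∷ 9 ∷ 13 ∷ []) Vec.∷
  (1 ∷ 8 ∷ 10 ∷ 17 ∷ []) Vec.∷
  (6 ∷ 9 ∷ 11 ∷ 15 ∷ []) Vec.∷
  (3 ∷ 10 ∷ 12 ∷ 18 ∷ []) Vec.∷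
  (1 ∷ 11 ∷ 13 ∷ 16 ∷ []) Vec.∷
  (5 ∷ 8 ∷ 12 ∷ 14 ∷ []) Vec.∷
  (2 ∷ 13 ∷ 15 ∷ 18 ∷ []) Vec.∷
  (4 ∷ 10 ∷ 14 ∷ 16 ∷ []) Vec.∷
  (7 ∷ 12 ∷ 15 ∷ 17 ∷ []) Vec.∷
  (5 ∷ 9 ∷ 16 ∷ 18 ∷ []) Vec.∷
  (0 ∷ 11 ∷ 14 ∷ 17 ∷ []) Vec.∷ Vec.[]

robertson : Graph 19
robertson = record
  { _~_    = Adj
  ; _~?_   = adj?
  ; sym    = λ {u} {v} → toWitness {a? = all? λ x → all? λ y → adj? x y →-dec adj? y x} _ u v
  ; irrefl = λ { {u} refl → toWitness {a? = all? λ x → ¬? (adj? x x)} _ u }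
  }
  where
  Adj : Rel (Fin 19) 0ℓ
  Adj u v = toℕ v ∈ lookup robertsonNeighbors u

  adj? : Decidable Adj
  adj? u v = DecMembership._∈?_ ℕ._≟_ (toℕ v) (lookup robertsonNeighbors u)

{-# OPTIONS --safe #-}
-- The Robertson graph is 4-regular of girth 5 with an explicit 3-coloring, while a
-- backtracking search lists all its proper k-colorings: none for k ≤ 2, and 24 for
-- k = 3, each with classes of sizes 5, 7, 7.  These facts are carried over along
-- isomorphisms.  A unique (4,5)-cage on 19 vertices already says that 19 is the
-- minimal order, so the Robertson graph is a (4,5)-cage too, and uniqueness makes
-- the two isomorphic.
module Submission where

open import Defs
open import Data.Bool using (true; false)
open import Data.Fin using (Fin; _≟_; #_)
open import Data.Fin.Properties using (all?)
open import Data.List using (List; []; _∷_; _∷ʳ_; map; allFin; filter; length; concatMap)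
open import Data.List.Membership.Propositional using (_∈_)
open import Data.List.Membership.Propositional.Properties
  using (∈-allFin; ∈-concatMap⁺; ∈-filter⁺; ∈-map⁺)
open import Data.List.Membership.Propositional.Properties.WithK using (unique∧set⇒bag)
open import Data.List.Properties using (filter-≐; length-map; map-++)
open import Data.List.Relation.Binary.BagAndSetEquality using (∼bag⇒↭)
open import Data.List.Relation.Binary.Permutation.Propositional using (_↭_)
open import Data.List.Relation.Binary.Permutation.Propositional.Properties
  using (∈-resp-↭; filter-↭; ↭-length)
open import Data.List.Relation.Unary.All as All using (All; _∷_)
import Data.List.Relation.Unary.All.Properties as All
import Data.List.Relation.Unary.Any as Any
open import Data.List.Relation.Unary.AllPairs using (_∷_)
open import Data.List.Relation.Unary.Linked as Linked using (Linked; _∷_; linked?)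
import Data.List.Relation.Unary.Linked.Properties as Linked
import Data.List.Relation.Unary.Unique.DecPropositional as DecUnique
open import Data.List.Relation.Unary.Unique.Propositional using (Unique)
import Data.List.Relation.Unary.Unique.Propositional.Properties as Unique
import Data.Nat as ℕ
open import Data.Nat using (ℕ; suc; _≤_; z≤n; s≤s; ∣_-_∣)
open import Data.Product using (∃; _×_; _,_; proj₁; proj₂)
open import Data.Sum using (_⊎_; inj₁; inj₂)
import Data.Vec as Vec
open import Function using (_∘_; Equivalence; Injection; Inverse; mk⇔)
open import Function.Construct.Symmetry using (↔-sym)
open import Function.Properties.Inverse using (↔⇒↣)
open import Level using (0ℓ)
open import Relation.Binary.PropositionalEquality
  using (_≡_; _≢_; refl; sym; trans; cong; subst; subst₂)
open import Relation.Nullary using (¬_; does; contradiction)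
open import Relation.Nullary.Decidable using (toWitness; ¬?; _→-dec_)
open import Relation.Unary using (Pred; Decidable)

private variable
  k m n : ℕ

-- Transport of graph invariants along isomorphisms.

length-filter-map : {A B : Set} {P : Pred B 0ℓ} (P? : Decidable P) (f : A → B) (xs : List A) →
  length (filter P? (map f xs)) ≡ length (filter (P? ∘ f) xs)
length-filter-map P? f [] = refl
length-filter-map P? f (x ∷ xs) with does (P? (f x))
... | true  = cong suc (length-filter-map P? f xs)
... | false = length-filter-map P? f xs

≅-sym : {G : Graph m} {H : Graph n} → G ≅ H → H ≅ G
≅-sym {H = H} (f , adj) = ↔-sym f , λ u v → mk⇔
  (λ u~v → Equivalence.from (adj _ _)
    (subst₂ (Graph._~_ H) (sym (strictlyInverseˡ u)) (sym (strictlyInverseˡ v)) u~v))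
  (λ u~v → subst₂ (Graph._~_ H) (strictlyInverseˡ u) (strictlyInverseˡ v)
    (Equivalence.to (adj _ _) u~v))
  where open Inverse f

module Isomorphism {G : Graph m} {H : Graph n} (iso : G ≅ H) where
  private
    module G = Graph G
    module H = Graph H

  open Inverse (proj₁ iso) using (to; strictlyInverseˡ)

  to-injective : ∀ {u v} → to u ≡ to v → u ≡ v
  to-injective = Injection.injective (↔⇒↣ (proj₁ iso))

  to-~ : ∀ {u v} → u G.~ v → to u H.~ to v
  to-~ = Equivalence.to (proj₂ iso _ _)

  -- Both lists are duplicate-free and contain every vertex of `H` (the first because `to` is
  -- surjective), so they agree as bags.
  map-to-allFin : map to (allFin m) ↭ allFin n
  map-to-allFin = ∼bag⇒↭ (unique∧set⇒bag
    (Unique.map⁺ to-injective (Unique.allFin⁺ m)) (Unique.allFin⁺ n)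
    (mk⇔ (λ _ → ∈-allFin _)
         (λ _ → subst (_∈ map to (allFin m)) (strictlyInverseˡ _) (∈-map⁺ to (∈-allFin _)))))

  -- Degrees and color class sizes are both such counts, so this serves to transport either.
  count-∘to : {P : Pred (Fin n) 0ℓ} (P? : Decidable P) →
    length (filter (P? ∘ to) (allFin m)) ≡ length (filter P? (allFin n))
  count-∘to P? = trans (sym (length-filter-map P? to (allFin m)))
                       (↭-length (filter-↭ P? map-to-allFin))

  degree-to : ∀ v → degree H (to v) ≡ degree G v
  degree-to v = trans (sym (count-∘to (to v H.~?_)))
    (cong length (filter-≐ _ (v G.~?_) (Equivalence.from (proj₂ iso _ _) , to-~) (allFin m)))

  IsCycle-map : ∀ {v vs} → IsCycle G v vs → IsCycle H (to v) (map to vs)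
  IsCycle-map {v} {vs} cyc = record
    { length≥3 = subst (3 ≤_) (sym (length-map to (v ∷ vs))) length≥3
    ; distinct = Unique.map⁺ to-injective distinct
    ; closed   = subst (Linked H._~_) (cong (to v ∷_) (map-++ to vs (v ∷ [])))
                   (Linked.map⁺ (Linked.map to-~ closed))
    }
    where open G.IsCycle cyc

  IsProper-∘to : {c : Fin n → Fin k} → IsProper H c → IsProper G (c ∘ to)
  IsProper-∘to proper u~v = proper (to-~ u~v)

  classSize-∘to : (c : Fin n → Fin k) (a : Fin k) → classSize (c ∘ to) a ≡ classSize c a
  classSize-∘to c a = count-∘to (λ v → c v ≟ a)

  IsColorable-≅ : IsColorable k H → IsColorable k G
  IsColorable-≅ (c , proper) = c ∘ to , IsProper-∘to {c = c} proper

  IsEquitablyColorable-≅ : IsEquitablyColorable k H → IsEquitablyColorable k G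
  IsEquitablyColorable-≅ (c , proper , equitable) =
    c ∘ to , IsProper-∘to {c = c} proper , λ a b →
      subst₂ (λ x y → ∣ x - y ∣ ≤ 1) (sym (classSize-∘to c a)) (sym (classSize-∘to c b))
        (equitable a b)

-- Existence and bounds travel in opposite directions: the cycle attaining the girth is moved from
-- `H` to `G` by the inverse, while an arbitrary cycle of `G` is moved to `H` to be bounded there.
-- Colorings pull back, so for them the directions are reversed.
IsRGχGraph-≅ : ∀ {r g χ} {G : Graph m} {H : Graph n} →
  G ≅ H → IsRGχGraph r g χ H → IsRGχGraph r g χ G
IsRGχGraph-≅ {g = g} {G = G} {H} iso
  (regular , ((v , vs , cyc , len) , shortest) , (colorable , least)) =
    (λ u → trans (sym (degree-to u)) (regular _))
  , ( (_ , _ , Back.IsCycle-map cyc , trans (length-map _ (v ∷ vs)) len)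
    , λ u us cyc′ → subst (g ≤_) (length-map _ (u ∷ us)) (shortest _ _ (IsCycle-map cyc′)) )
  , (IsColorable-≅ colorable , λ k → least k ∘ Back.IsColorable-≅)
  where
  open Isomorphism {G = G} {H} iso
  module Back = Isomorphism {G = H} {G} (≅-sym {G = G} {H} iso)

-- Exhaustive search for proper colorings.

module Search (G : Graph n) where
  open Graph G using (_~_; _~?_)

  PartialColoring : ℕ → Set
  PartialColoring k = List (Fin n × Fin k)

  -- Only edges at the new vertex `v` are tested; those among earlier vertices were tested when
  -- these were colored.
  Compatible : Fin n → PartialColoring k → Fin k → Set
  Compatible v p a = All (λ (u , b) → v ~ u → a ≢ b) p

  compatible? : (v : Fin n) (p : PartialColoring k) → Decidable (Compatible v p)
  compatible? v p a = All.all? (λ (u , b) → (v ~? u) →-dec ¬? (a ≟ b)) p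

  extensions : Fin n → PartialColoring k → List (PartialColoring k)
  extensions v p = map (λ a → (v , a) ∷ p) (filter (compatible? v p) (allFin _))

  colorings : (k : ℕ) → List (Fin n) → List (PartialColoring k)
  colorings k []       = [] ∷ []
  colorings k (v ∷ vs) = concatMap (extensions v) (colorings k vs)

  restrict : (Fin n → Fin k) → List (Fin n) → PartialColoring k
  restrict c = map (λ v → v , c v)

  -- Properness makes `c v` compatible with the restriction of `c` to `vs`, so the branch that
  -- follows `c` is never pruned.
  restrict∈colorings : {c : Fin n → Fin k} → IsProper G c →
    ∀ vs → restrict c vs ∈ colorings k vs
  restrict∈colorings proper [] = Any.here refl
  restrict∈colorings {c = c} proper (v ∷ vs) =
    ∈-concatMap⁺ (extensions v) (Any.map (λ { refl →
      ∈-map⁺ _ (∈-filter⁺ (compatible? v _) (∈-allFin (c v))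
        (All.map⁺ (All.universal (λ _ → proper) vs))) })
      (restrict∈colorings {c = c} proper vs))

  -- Sizes are read off the list, so that equitability of a search result is decided by evaluation.
  size : PartialColoring k → Fin k → ℕ
  size p a = length (filter (λ (_ , b) → b ≟ a) p)

  size-restrict : (c : Fin n → Fin k) (a : Fin k) →
    size (restrict c (allFin n)) a ≡ classSize c a
  size-restrict c a = length-filter-map _ _ (allFin n)

  Equitable : PartialColoring k → Set
  Equitable p = ∀ a b → ∣ size p a - size p b ∣ ≤ 1

  equitable? : Decidable (Equitable {k})
  equitable? p = all? λ a → all? λ b → ∣ size p a - size p b ∣ ℕ.≤? 1

  colorable⇒colorings≢[] : IsColorable k G → colorings k (allFin n) ≢ []
  colorable⇒colorings≢[] (c , proper) eq
    with () ← subst (_ ∈_) eq (restrict∈colorings {c = c} proper (allFin n))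

  ¬equitablyColorable : All (¬_ ∘ Equitable) (colorings k (allFin n)) → ¬ IsEquitablyColorable k G
  ¬equitablyColorable none (c , proper , equitable) =
    All.lookup none (restrict∈colorings {c = c} proper (allFin n)) λ a b →
      subst₂ (λ x y → ∣ x - y ∣ ≤ 1) (sym (size-restrict c a)) (sym (size-restrict c b))
        (equitable a b)

-- Regularity, girth and colorings of the Robertson graph.

open Graph robertson using (_~_; _~?_)

robertson-regular : IsRegular 4 robertson
robertson-regular = toWitness {a? = all? λ v → degree robertson v ℕ.≟ 4} _

-- Each adjacency precedes the next quantifier, so the decision procedure extends only walks along
-- edges instead of checking all triples.
no-triangle : ∀ u v → u ~ v → ∀ w → v ~ w → ¬ w ~ u
no-triangle = toWitness
  {a? = all? λ u → all? λ v → (u ~? v) →-dec all? λ w → (v ~? w) →-dec ¬? (w ~? u)} _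

-- The hypotheses `u ≢ w` and `v ≢ x` exclude the closed walks of length 4 that retrace an edge.
no-square : ∀ u v → u ~ v → ∀ w → v ~ w → u ≢ w → ∀ x → w ~ x → v ≢ x → ¬ x ~ u
no-square = toWitness
  {a? = all? λ u → all? λ v → (u ~? v) →-dec all? λ w → (v ~? w) →-dec (¬? (u ≟ w) →-dec
        all? λ x → (w ~? x) →-dec (¬? (v ≟ x) →-dec ¬? (x ~? u)))} _

robertson-girth : HasGirth 5 robertson
robertson-girth = (# 0 , pentagon , record
    { length≥3 = s≤s (s≤s (s≤s z≤n))
    ; distinct = toWitness {a? = DecUnique.unique? _≟_ (# 0 ∷ pentagon)} _
    ; closed   = toWitness {a? = linked? _~?_ (# 0 ∷ pentagon ∷ʳ # 0)} _
    } , refl) , shortest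
  where
  -- The chord from 4 to 0 closes a path of the Hamiltonian cycle.
  pentagon : List (Fin 19)
  pentagon = # 1 ∷ # 2 ∷ # 3 ∷ # 4 ∷ []

  shortest : ∀ v vs → IsCycle robertson v vs → 5 ≤ length (v ∷ vs)
  shortest v vs record { length≥3 = l ; distinct = d ; closed = e } = bound vs l d e
    where
    bound : ∀ vs → 3 ≤ length (v ∷ vs) → Unique (v ∷ vs) → Linked _~_ (v ∷ vs ∷ʳ v) →
      5 ≤ length (v ∷ vs)
    bound []          (s≤s ())
    bound (_ ∷ [])    (s≤s (s≤s ()))
    bound (a ∷ b ∷ []) _ _ (v~a ∷ a~b ∷ b~v ∷ _) =
      contradiction b~v (no-triangle v a v~a b a~b)
    -- `Unique` supplies the distinctness of the opposite corners `v`, `b` and `a`, `c`.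
    bound (a ∷ b ∷ c ∷ []) _ ((_ ∷ v≢b ∷ _) ∷ (_ ∷ a≢c ∷ _) ∷ _) (v~a ∷ a~b ∷ b~c ∷ c~v ∷ _) =
      contradiction c~v (no-square v a v~a b a~b v≢b c b~c a≢c)
    bound (_ ∷ _ ∷ _ ∷ _ ∷ _) _ _ _ = s≤s (s≤s (s≤s (s≤s (s≤s z≤n))))

robertson-colorable : IsColorable 3 robertson
robertson-colorable = c , λ {u} {v} → toWitness
  {a? = all? λ u → all? λ v → (u ~? v) →-dec ¬? (c u ≟ c v)} _ u v
  where
  -- The color classes have sizes 5, 7, 7.
  c : Fin 19 → Fin 3
  c = Vec.lookup
    ( # 0 Vec.∷ # 1 Vec.∷ # 0 Vec.∷ # 2 Vec.∷ # 1 Vec.∷ # 2 Vec.∷ # 1 Vec.∷ # 2 Vec.∷ # 1 Vec.∷ # 2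
    Vec.∷ # 0 Vec.∷ # 1 Vec.∷ # 2 Vec.∷ # 0 Vec.∷ # 1 Vec.∷ # 2 Vec.∷ # 0 Vec.∷ # 1 Vec.∷ # 2 Vec.∷ Vec.[])

robertson-chromaticNumber : HasChromaticNumber 3 robertson
robertson-chromaticNumber = robertson-colorable , atLeast
  where
  open Search robertson using (colorable⇒colorings≢[])

  atLeast : ∀ k → IsColorable k robertson → 3 ≤ k
  -- For each `k` below 3 the search evaluates to the empty list, whence `refl`.
  atLeast 0 col = contradiction refl (colorable⇒colorings≢[] col)
  atLeast 1 col = contradiction refl (colorable⇒colorings≢[] col)
  atLeast 2 col = contradiction refl (colorable⇒colorings≢[] col)
  atLeast (suc (suc (suc _))) _ = s≤s (s≤s (s≤s z≤n))

robertson-rgχ : IsRGχGraph 4 5 3 robertson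
robertson-rgχ = robertson-regular , robertson-girth , robertson-chromaticNumber

robertson-¬equitable : ¬ IsEquitablyColorable 3 robertson
robertson-¬equitable = ¬equitablyColorable
  -- Evaluation runs through all listed colorings and finds in each two class sizes that differ by
  -- more than 1.
  (toWitness {a? = All.all? (¬? ∘ equitable?) (colorings 3 (allFin 19))} _)
  where open Search robertson

-- From the Robertson graph to `G`.

uniqueCage⇒≅robertson : {G : Graph 19} → IsUniqueCage 4 5 G → G ≅ robertson
uniqueCage⇒≅robertson {G} ((_ , minimal) , unique) = ≅-sym {G = robertson} {G}
  -- `minimal` bounds the order of every (4,5)-graph below by 19 without mentioning `G`, so it
  -- serves for `robertson` unchanged.
  (unique robertson ((robertson-regular , robertson-girth) , minimal))

-- The permutation leaves open which color has which size, but every size lies in the list 6, 6, 7,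
-- and any two entries of it differ by at most 1.
sizes667⇒equitable : (c : Fin 19 → Fin 3) →
  map (classSize c) (allFin 3) ↭ 6 ∷ 6 ∷ 7 ∷ [] → IsEquitable c
sizes667⇒equitable c σ a b = All.lookup (All.lookup close (size∈ a)) (size∈ b)
  where
  sizes : List ℕ
  sizes = 6 ∷ 6 ∷ 7 ∷ []

  size∈ : ∀ a → classSize c a ∈ sizes
  size∈ a = ∈-resp-↭ σ (∈-map⁺ (classSize c) (∈-allFin a))

  close : All (λ x → All (λ y → ∣ x - y ∣ ≤ 1) sizes) sizes
  close = toWitness {a? = All.all? (λ x → All.all? (λ y → ∣ x - y ∣ ℕ.≤? 1) sizes) sizes} _

theorem6p1 : (G : Graph 19) → IsUniqueCage 4 5 G ⊎ G ≅ robertson →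
    IsRGχGraph 4 5 3 G
    × ¬ IsEquitableCage 4 5 3 G
    × ¬ IsEquitablyColorable 3 G
    × ¬ (∃ λ (c : Fin 19 → Fin 3) → IsProper G c × map (classSize c) (allFin 3) ↭ 6 ∷ 6 ∷ 7 ∷ [])
theorem6p1 G hyp =
    IsRGχGraph-≅ {G = G} {robertson} iso robertson-rgχ
  , (λ cage → ¬equitable (proj₂ (proj₁ cage)))
  , ¬equitable
  , λ (c , proper , σ) → ¬equitable (c , (λ {u} {v} → proper {u} {v}) , sizes667⇒equitable c σ)
  where
  isomorphic : IsUniqueCage 4 5 G ⊎ G ≅ robertson → G ≅ robertson
  isomorphic (inj₁ cage) = uniqueCage⇒≅robertson {G} cage
  isomorphic (inj₂ iso)  = iso

  iso : G ≅ robertson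
  iso = isomorphic hyp

  ¬equitable : ¬ IsEquitablyColorable 3 G
  ¬equitable = robertson-¬equitable
    ∘ Isomorphism.IsEquitablyColorable-≅ {G = robertson} {G} (≅-sym {G = G} {robertson} iso)
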